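{- Seidel matrices of order $18$ with spectrum $\{[-9]^3,[1]^9,[3]^6\}$ do not exist.
   Context: A Seidel matrix of order $n$ is an $n\times n$ symmetric matrix with zero diagonal and all off-diagonal entries equal to $\pm1$. The spectrum is the multiset of eigenvalues, and $[\lambda]^a$ means that the eigenvalue $\lambda$ has multiplicity $a$. -}

module Defs where

open import Algebra.Bundles.Raw using (RawRing)
import Algebra.Definitions.RawSemiring as RawSemiringDefs
open import Data.Bool.Base using (if_then_else_)
open import Data.Fin.Base using (Fin; zero; suc; toℕ)
open import Data.Fin.Properties using (_≟_)
open import Data.Integer.Base as ℤ using (ℤ; 0ℤ; 1ℤ; -1ℤ)
open import Data.List.Base as List using (List; []; _∷_; replicate)
open import Data.Nat.Base as ℕ using (ℕ; zero; suc)
open import Data.Sum.Base using (_⊎_)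
open import Data.Vec.Functional using (Vector; removeAt)
open import Level using (Level; 0ℓ)
open import Relation.Binary.PropositionalEquality using (_≡_; _≢_)
open import Relation.Nullary.Decidable using (does)

private
  variable
    a c ℓ : Level
    n : ℕ

Matrix : Set a → ℕ → Set a
Matrix A n = Vector (Vector A n) n

------------------------------------------------------------------------
-- Determinants

module Determinant (R : RawRing c ℓ) where

  open RawRing R
  open RawSemiringDefs rawSemiring using (sum; _^_)

  -- Laplace expansion along the first row.
  det : ∀ {n} → Matrix Carrier n → Carrier
  det {zero}  M = 1#
  det {suc n} M =
    sum λ j → (- 1#) ^ toℕ j * (M zero j * det λ i → removeAt (M (suc i)) j)

------------------------------------------------------------------------
-- Polynomials in one variable over ℤ

-- Coefficients in order of increasing degree.  Trailing zeros are allowed,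
-- so equality is coefficientwise rather than propositional.
Poly : Set
Poly = List ℤ

coeff : Poly → ℕ → ℤ
coeff []      k       = 0ℤ
coeff (a ∷ p) zero    = a
coeff (a ∷ p) (suc k) = coeff p k

infix  4 _≈ᴾ_
infixl 6 _+ᴾ_
infixl 7 _*ᴾ_
infix  8 -ᴾ_

_≈ᴾ_ : Poly → Poly → Set
p ≈ᴾ q = ∀ k → coeff p k ≡ coeff q k

_+ᴾ_ : Poly → Poly → Poly
[]      +ᴾ q       = q
(a ∷ p) +ᴾ []      = a ∷ p
(a ∷ p) +ᴾ (b ∷ q) = (a ℤ.+ b) ∷ (p +ᴾ q)

-ᴾ_ : Poly → Poly
-ᴾ_ = List.map (ℤ.-_)

_*ᴾ_ : Poly → Poly → Poly
[]      *ᴾ q = []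
(a ∷ p) *ᴾ q = List.map (a ℤ.*_) q +ᴾ (0ℤ ∷ (p *ᴾ q))

polyRawRing : RawRing 0ℓ 0ℓ
polyRawRing = record
  { Carrier = Poly
  ; _≈_     = _≈ᴾ_
  ; _+_     = _+ᴾ_
  ; _*_     = _*ᴾ_
  ; -_      = -ᴾ_
  ; 0#      = []
  ; 1#      = 1ℤ ∷ []
  }

constᴾ : ℤ → Poly
constᴾ a = a ∷ []

X : Poly
X = 0ℤ ∷ 1ℤ ∷ []

productᴾ : List Poly → Poly
productᴾ = List.foldr _*ᴾ_ (constᴾ 1ℤ)

------------------------------------------------------------------------
-- Spectra

-- det (X I - M)
charPoly : Matrix ℤ n → Poly
charPoly M = det λ i j → (if does (i ≟ j) then X else []) +ᴾ (-ᴾ constᴾ (M i j))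
  where open Determinant polyRawRing

-- The eigenvalues of M, with multiplicity, are the roots of its characteristic
-- polynomial.  Hence the multiset listed by λs (the order is irrelevant, as
-- multiplication of polynomials is commutative) is the whole spectrum exactly
-- when the characteristic polynomial is the product of the factors X - λ.
record HasSpectrum (M : Matrix ℤ n) (λs : List ℤ) : Set where
  field
    charPoly-splits :
      charPoly M ≈ᴾ productᴾ (List.map (λ μ → X +ᴾ (-ᴾ constᴾ μ)) λs)

[_]^_ : ℤ → ℕ → List ℤ
[ μ ]^ a = replicate a μ

------------------------------------------------------------------------
-- Seidel matrices

record IsSeidel (S : Matrix ℤ n) : Set where
  field
    symmetric    : ∀ i j → S i j ≡ S j i
    diagonal     : ∀ i → S i i ≡ 0ℤ
    off-diagonal : ∀ i j → i ≢ j → S i j ≡ 1ℤ ⊎ S i j ≡ -1ℤ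

{-# OPTIONS --safe #-}
-- By the Cayley–Hamilton theorem a power of (S + 9)(S - 1)(S - 3) vanishes, and
-- since S is symmetric, (S + 9)(S - 1)(S - 3) = 0 itself.  This gives the
-- diagonal entries (S³)ᵢᵢ = -112 and (S⁴)ᵢᵢ = 1121.
--
-- On the other hand, call a triangle ijk positive if Sᵢⱼ Sⱼₖ Sᵢₖ = 1.  Each
-- quadruple contains an even number of positive triangles.  So if ijk is
-- positive, then each other vertex l lies in one or three positive triangles
-- together with an edge of ijk.  Writing t for the number of positive triangles
-- on an edge, the sum of t over the edges of a positive triangle is thus at
-- least n, and so Σ t² ≥ n Σ t / 3, with sums over all edges.  The traces of S³
-- and S⁴ give Σ t = 720 and Σ t² = 3600, whereas 18 · 720 / 3 = 4320.
module Submission where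

open import Defs
open import Algebra.Bundles using (CommutativeRing)
open import Algebra.Bundles.Raw using (RawRing)
import Algebra.Definitions.RawSemiring as RawSemiringDefs
import Algebra.Properties.Ring as RingProperties
import Algebra.Properties.Semiring.Sum as SemiringSum
open import Algebra.Structures using (IsCommutativeRing)
open import Data.Bool.Base using (true; false; if_then_else_)
open import Data.Empty using (⊥)
open import Data.Fin.Base using (Fin; zero; suc; toℕ; punchIn; punchOut)
open import Data.Fin.Properties using (_≟_; punchIn-injective; punchInᵢ≢i; punchIn-punchOut; suc-injective)
open import Data.Integer.Base as ℤ using (ℤ; 0ℤ; 1ℤ; -1ℤ)
import Data.Integer.Properties as ℤ
open import Data.Integer.Tactic.RingSolver using (solve-∀)
open import Data.List.Base as List using (List; []; _∷_; _++_)
open import Data.List.Properties using (≡-dec)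
open import Data.Nat.Base using (ℕ; zero; suc; z≤n; _<_)
import Data.Nat.Properties as ℕ
open import Data.Product.Base using (∃; _×_; _,_; proj₁; proj₂)
open import Data.Sum.Base using (_⊎_; inj₁; inj₂; reduce)
open import Data.Vec.Functional using (Vector; removeAt; updateAt)
open import Data.Vec.Functional.Properties using (updateAt-updates; updateAt-minimal; updateAt-commutes)
open import Function.Base using (_∘_)
open import Relation.Binary.Core using (Rel)
open import Relation.Binary.PropositionalEquality as ≡ using (_≡_; _≢_; cong)
open import Relation.Nullary.Decidable using (Dec; does; yes; no; map′; _×-dec_; from-yes)
open import Relation.Nullary.Negation.Core using (¬_; contradiction)

private
  variable
    n : ℕ

-- Determinants over commutative rings

-- An inductive form of "`q` is the successor of `p`", so that proofs can recurse on it in step with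
-- `punchOut` and `removeAt`.
data Adjacent : Fin n → Fin n → Set where
  base : Adjacent {suc (suc n)} zero (suc zero)
  step : {p q : Fin n} → Adjacent p q → Adjacent (suc p) (suc q)

Adjacent-toℕ : {p q : Fin n} → Adjacent p q → toℕ q ≡ suc (toℕ p)
Adjacent-toℕ base     = ≡.refl
Adjacent-toℕ (step a) = cong suc (Adjacent-toℕ a)

Adjacent⇒≢ : {p q : Fin n} → Adjacent p q → p ≢ q
Adjacent⇒≢ (step a) eq = Adjacent⇒≢ a (suc-injective eq)

-- Needed for Laplace expansion: a minor that omits neither of two neighbouring columns still has
-- them side by side.
Adjacent-punchOut : {p q i : Fin (suc n)} → Adjacent p q →
                    (i≢p : i ≢ p) (i≢q : i ≢ q) → Adjacent (punchOut i≢p) (punchOut i≢q)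
Adjacent-punchOut {i = zero} base i≢p i≢q = contradiction ≡.refl i≢p
Adjacent-punchOut {i = suc zero} base i≢p i≢q = contradiction ≡.refl i≢q
Adjacent-punchOut {n = suc (suc _)} {i = suc (suc i)} base i≢p i≢q = base
Adjacent-punchOut {i = zero} (step a) i≢p i≢q = a
Adjacent-punchOut {n = suc _} {i = suc i} (step a) i≢p i≢q =
  step (Adjacent-punchOut a (i≢p ∘ cong suc) (i≢q ∘ cong suc))

-- The strict order as a chain of adjacent steps, which is how a column is carried towards another
-- by swaps of neighbours.
data Before : Fin n → Fin n → Set where
  next : {p q : Fin n} → Adjacent p q → Before p q
  skip : {p m q : Fin n} → Adjacent p m → Before m q → Before p q

Before-suc : {p q : Fin n} → Before p q → Before (suc p) (suc q)
Before-suc (next a)   = next (step a)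
Before-suc (skip a b) = skip (step a) (Before-suc b)

0-Before-suc : (q : Fin n) → Before zero (suc q)
0-Before-suc zero    = next base
0-Before-suc (suc q) = skip base (Before-suc (0-Before-suc q))

≢⇒Before : (p q : Fin n) → p ≢ q → Before p q ⊎ Before q p
≢⇒Before zero    zero    p≢q = contradiction ≡.refl p≢q
≢⇒Before zero    (suc q) _   = inj₁ (0-Before-suc q)
≢⇒Before (suc p) zero    _   = inj₂ (0-Before-suc p)
≢⇒Before (suc p) (suc q) p≢q with ≢⇒Before p q (p≢q ∘ cong suc)
... | inj₁ b = inj₁ (Before-suc b)
... | inj₂ b = inj₂ (Before-suc b)

Before-irrefl : {p : Fin n} → ¬ Before p p
Before-irrefl b = ℕ.<-irrefl ≡.refl (mono b)
  where
  mono : {p q : Fin n} → Before p q → toℕ p < toℕ q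
  mono (next a)   = ℕ.≤-reflexive (≡.sym (Adjacent-toℕ a))
  mono (skip a b) = ℕ.<-trans (ℕ.≤-reflexive (≡.sym (Adjacent-toℕ a))) (mono b)

-- The equality of R plays no role in determinants, so the ring laws may hold
-- with respect to any other equality _∼_.
module DeterminantTheory
  {c ℓ ℓ′} (R : RawRing c ℓ) {_∼_ : Rel (RawRing.Carrier R) ℓ′}
  (isCommutativeRing : IsCommutativeRing _∼_
    (RawRing._+_ R) (RawRing._*_ R) (RawRing.-_ R) (RawRing.0# R) (RawRing.1# R)) where

  open RawRing R hiding (_≈_)

  private
    commutativeRing : CommutativeRing c ℓ′
    commutativeRing = record { isCommutativeRing = isCommutativeRing }

  open CommutativeRing commutativeRing
    using ( _≈_; setoid; refl; sym; trans; reflexive; +-cong; +-congˡ; +-congʳ; *-cong; *-congˡ; *-congʳ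
          ; +-identityˡ; +-identityʳ; zeroˡ; zeroʳ; distribʳ; -‿inverseʳ; ring; semiring
          ; commutativeSemiring)
  open RingProperties ring using (-1*x≈-x)
  open SemiringSum semiring
    using (sum-cong-≋; sum-replicate-zero; ∑-distrib-+; ∑-comm; *-distribˡ-sum)
  open RawSemiringDefs rawSemiring using (sum; _^_)
  open Determinant R
  open import Relation.Binary.Reasoning.Setoid setoid
  open import Algebra.Solver.Ring.NaturalCoefficients.Default commutativeSemiring
    using (solve; _:*_; _:=_)

  -- Linearity of the determinant in a column

  minor : Matrix Carrier (suc n) → Fin (suc n) → Matrix Carrier n
  minor A i r = removeAt (A (suc r)) i

  expansionTerm : Matrix Carrier (suc n) → Fin (suc n) → Carrier
  expansionTerm A i = (- 1#) ^ toℕ i * (A zero i * det (minor A i))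

  sum-zero : {g : Vector Carrier n} → (∀ i → g i ≈ 0#) → sum g ≈ 0#
  sum-zero {n = n} g≈0 = trans (sum-cong-≋ g≈0) (sum-replicate-zero n)

  det-cong : {A B : Matrix Carrier n} → (∀ r k → A r k ≈ B r k) → det A ≈ det B
  det-cong {n = zero}  A≈B = refl
  det-cong {n = suc n} A≈B = sum-cong-≋ λ i →
    *-congˡ {x = (- 1#) ^ toℕ i} (*-cong (A≈B zero i) (det-cong λ r k → A≈B (suc r) (punchIn i k)))

  -- The vector C consists of the cofactors of the j-th column.
  det-linear : (A : Matrix Carrier n) (j : Fin n) →
    ∃ λ (C : Vector Carrier n) → ∀ (B : Matrix Carrier n) →
      (∀ r k → k ≢ j → B r k ≈ A r k) → det B ≈ sum (λ r → B r j * C r)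
  det-linear {n = suc n} A j = (λ r → sum λ i → proj₁ (termLinear i) r) , linear
    where
    Agrees : Matrix Carrier (suc n) → Set ℓ′
    Agrees B = ∀ r k → k ≢ j → B r k ≈ A r k

    termLinear : ∀ i → ∃ λ D → ∀ B → Agrees B → expansionTerm B i ≈ sum (λ r → B r j * D r)
    -- If `i` is the column `j`, the minor omits that column and only the entry in the first row
    -- varies. Otherwise that entry is fixed, and the minor is linear in its column `punchOut i≢j`
    -- by induction.
    termLinear i with i ≟ j
    ... | yes ≡.refl = D , proof
      where
      s = (- 1#) ^ toℕ i
      D : Vector Carrier (suc n)
      D zero    = s * det (minor A i)
      D (suc r) = 0#
      proof : ∀ B → Agrees B → expansionTerm B i ≈ sum (λ r → B r i * D r)
      proof B agrees = begin
        s * (B zero i * det (minor B i))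
          ≈⟨ *-congˡ (*-congˡ (det-cong λ r k → agrees (suc r) (punchIn i k) (punchInᵢ≢i i k))) ⟩
        s * (B zero i * det (minor A i))
          ≈⟨ solve 3 (λ s b m → s :* (b :* m) := b :* (s :* m)) refl s (B zero i) (det (minor A i)) ⟩
        B zero i * (s * det (minor A i))
          ≈⟨ sym (+-identityʳ _) ⟩
        B zero i * D zero + 0#
          ≈⟨ +-congˡ (sym (sum-zero λ r → zeroʳ (B (suc r) i))) ⟩
        B zero i * D zero + sum (λ r → B (suc r) i * 0#) ∎
    ... | no i≢j = D , proof
      where
      s  = (- 1#) ^ toℕ i
      IH = det-linear (minor A i) (punchOut i≢j)
      C′ = proj₁ IH
      D : Vector Carrier (suc n)
      D zero    = 0#
      D (suc r) = s * (A zero i * C′ r)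
      minorAgrees : ∀ B → Agrees B → ∀ r k → k ≢ punchOut i≢j → minor B i r k ≈ minor A i r k
      minorAgrees B agrees r k k≢ = agrees (suc r) (punchIn i k)
        λ eq → k≢ (punchIn-injective i k _ (≡.trans eq (≡.sym (punchIn-punchOut i≢j))))
      proof : ∀ B → Agrees B → expansionTerm B i ≈ sum (λ r → B r j * D r)
      proof B agrees = begin
        s * (B zero i * det (minor B i))
          ≈⟨ *-congˡ (*-cong (agrees zero i i≢j) (proj₂ IH (minor B i) (minorAgrees B agrees))) ⟩
        s * (A zero i * sum (λ r → B (suc r) (punchIn i (punchOut i≢j)) * C′ r))
          ≈⟨ *-congˡ (*-distribˡ-sum (A zero i) (λ r → B (suc r) (punchIn i (punchOut i≢j)) * C′ r)) ⟩
        s * sum (λ r → A zero i * (B (suc r) (punchIn i (punchOut i≢j)) * C′ r))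
          ≈⟨ *-distribˡ-sum s (λ r → A zero i * (B (suc r) (punchIn i (punchOut i≢j)) * C′ r)) ⟩
        sum (λ r → s * (A zero i * (B (suc r) (punchIn i (punchOut i≢j)) * C′ r)))
          ≈⟨ sum-cong-≋ (λ r → trans
               (*-congˡ (*-congˡ (*-congʳ (reflexive (cong (B (suc r)) (punchIn-punchOut i≢j))))))
               (solve 4 (λ s a b c → s :* (a :* (b :* c)) := b :* (s :* (a :* c)))
                  refl s (A zero i) (B (suc r) j) (C′ r))) ⟩
        sum (λ r → B (suc r) j * D (suc r))
          ≈⟨ sym (+-identityˡ _) ⟩
        0# + sum (λ r → B (suc r) j * D (suc r))
          ≈⟨ +-congʳ (sym (zeroʳ (B zero j))) ⟩
        sum (λ r → B r j * D r) ∎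

    linear : ∀ B → Agrees B → det B ≈ sum (λ r → B r j * sum (λ i → proj₁ (termLinear i) r))
    linear B agrees = begin
      sum (expansionTerm B)
        ≈⟨ sum-cong-≋ (λ i → proj₂ (termLinear i) B agrees) ⟩
      sum (λ i → sum λ r → B r j * proj₁ (termLinear i) r)
        ≈⟨ ∑-comm (λ i r → B r j * proj₁ (termLinear i) r) ⟩
      sum (λ r → sum λ i → B r j * proj₁ (termLinear i) r)
        ≈⟨ sum-cong-≋ (λ r → sym (*-distribˡ-sum (B r j) (λ i → proj₁ (termLinear i) r))) ⟩
      sum (λ r → B r j * sum (λ i → proj₁ (termLinear i) r)) ∎

  -- Vanishing of the determinant when two columns agree

  sum-pair : {p q : Fin n} → Adjacent p q → (g : Vector Carrier n) → g p + g q ≈ 0# →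
             (∀ i → i ≢ p → i ≢ q → g i ≈ 0#) → sum g ≈ 0#
  sum-pair base g pair≈0 rest≈0 = begin
    g zero + (g (suc zero) + sum (λ i → g (suc (suc i))))
      ≈⟨ +-congˡ (+-congˡ (sum-zero λ i → rest≈0 (suc (suc i)) (λ ()) (λ ()))) ⟩
    g zero + (g (suc zero) + 0#)
      ≈⟨ +-congˡ (+-identityʳ _) ⟩
    g zero + g (suc zero)
      ≈⟨ pair≈0 ⟩
    0# ∎
  sum-pair (step a) g pair≈0 rest≈0 = begin
    g zero + sum (g ∘ suc)
      ≈⟨ +-cong (rest≈0 zero (λ ()) (λ ()))
           (sum-pair a (g ∘ suc) pair≈0 λ i i≢p i≢q →
             rest≈0 (suc i) (i≢p ∘ suc-injective) (i≢q ∘ suc-injective)) ⟩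
    0# + 0#
      ≈⟨ +-identityˡ 0# ⟩
    0# ∎

  -- Either deletion leaves one of the two neighbours, in the same position; all other entries are
  -- shared.
  removeAt-adjacent : {p q : Fin (suc n)} → Adjacent p q → (f : Vector Carrier (suc n)) →
                      f p ≈ f q → ∀ k → removeAt f p k ≈ removeAt f q k
  removeAt-adjacent base     f fp≈fq zero    = sym fp≈fq
  removeAt-adjacent base     f fp≈fq (suc k) = refl
  removeAt-adjacent (step a) f fp≈fq zero    = refl
  removeAt-adjacent {n = suc _} (step a) f fp≈fq (suc k) = removeAt-adjacent a (f ∘ suc) fp≈fq k

  -- In the expansion the terms of `p` and `q` have equal entries and equal minors but opposite
  -- signs, so they cancel. Every other minor again has two equal adjacent columns and vanishes by
  -- induction.
  det-adjacent-equal : {p q : Fin n} → Adjacent p q → (A : Matrix Carrier n) →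
                       (∀ r → A r p ≈ A r q) → det A ≈ 0#
  det-adjacent-equal {n = suc n} {p} {q} a A eq = sum-pair a (expansionTerm A) pair≈0 rest≈0
    where
    s = (- 1#) ^ toℕ p
    x = A zero p * det (minor A p)
    pair≈0 : expansionTerm A p + expansionTerm A q ≈ 0#
    pair≈0 = begin
      s * x + (- 1#) ^ toℕ q * (A zero q * det (minor A q))
        ≈⟨ +-congˡ (*-cong (reflexive (cong ((- 1#) ^_) (Adjacent-toℕ a)))
             (*-cong (sym (eq zero))
               (det-cong λ r k → sym (removeAt-adjacent a (A (suc r)) (eq (suc r)) k)))) ⟩
      s * x + (- 1# * s) * x
        ≈⟨ sym (distribʳ x s (- 1# * s)) ⟩
      (s + - 1# * s) * x
        ≈⟨ *-congʳ (+-congˡ (-1*x≈-x s)) ⟩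
      (s + - s) * x
        ≈⟨ *-congʳ (-‿inverseʳ s) ⟩
      0# * x
        ≈⟨ zeroˡ x ⟩
      0# ∎
    rest≈0 : ∀ i → i ≢ p → i ≢ q → expansionTerm A i ≈ 0#
    rest≈0 i i≢p i≢q = trans (*-congˡ (trans (*-congˡ minor≈0) (zeroʳ _))) (zeroʳ _)
      where
      minor≈0 : det (minor A i) ≈ 0#
      minor≈0 = det-adjacent-equal (Adjacent-punchOut a i≢p i≢q) (minor A i) λ r →
        trans (reflexive (cong (A (suc r)) (punchIn-punchOut i≢p)))
          (trans (eq (suc r)) (reflexive (cong (A (suc r)) (≡.sym (punchIn-punchOut i≢q)))))

  setColumn : Matrix Carrier n → Fin n → Vector Carrier n → Matrix Carrier n
  setColumn A j v r = updateAt (A r) j (λ _ → v r)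

  setColumn-at : (A : Matrix Carrier n) (j : Fin n) (v : Vector Carrier n) → ∀ r →
                 setColumn A j v r j ≡ v r
  setColumn-at A j v r = updateAt-updates j (A r)

  setColumn-off : (A : Matrix Carrier n) (j : Fin n) (v : Vector Carrier n) → ∀ r {k} → k ≢ j →
                  setColumn A j v r k ≡ A r k
  setColumn-off A j v r {k} k≢j = updateAt-minimal k j (A r) k≢j

  det-setColumn : (A : Matrix Carrier n) (j : Fin n) (v : Vector Carrier n) →
                  det (setColumn A j v) ≈ sum (λ r → v r * proj₁ (det-linear A j) r)
  det-setColumn A j v = trans
    (proj₂ (det-linear A j) (setColumn A j v) λ r k k≢j → reflexive (setColumn-off A j v r k≢j))
    (sum-cong-≋ λ r → *-congʳ (reflexive (setColumn-at A j v r)))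

  det-setColumn-+ : (A : Matrix Carrier n) (j : Fin n) (v w : Vector Carrier n) →
    det (setColumn A j (λ r → v r + w r)) ≈ det (setColumn A j v) + det (setColumn A j w)
  det-setColumn-+ A j v w = begin
    det (setColumn A j (λ r → v r + w r))
      ≈⟨ det-setColumn A j _ ⟩
    sum (λ r → (v r + w r) * C r)
      ≈⟨ sum-cong-≋ (λ r → distribʳ (C r) (v r) (w r)) ⟩
    sum (λ r → v r * C r + w r * C r)
      ≈⟨ ∑-distrib-+ (λ r → v r * C r) (λ r → w r * C r) ⟩
    sum (λ r → v r * C r) + sum (λ r → w r * C r)
      ≈⟨ sym (+-cong (det-setColumn A j v) (det-setColumn A j w)) ⟩
    det (setColumn A j v) + det (setColumn A j w) ∎
    where C = proj₁ (det-linear A j)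

  module _ {p q : Fin n} (a : Adjacent p q) (A : Matrix Carrier n) where

    private
      p≢q : p ≢ q
      p≢q = Adjacent⇒≢ a

      D : Vector Carrier n → Vector Carrier n → Carrier
      D v w = det (setColumn (setColumn A p v) q w)

      D-+ʳ : ∀ v w w′ → D v (λ r → w r + w′ r) ≈ D v w + D v w′
      D-+ʳ v = det-setColumn-+ (setColumn A p v) q

      D-comm : ∀ v w → D v w ≈ det (setColumn (setColumn A q w) p v)
      D-comm v w = det-cong λ r k → reflexive (updateAt-commutes q p (p≢q ∘ ≡.sym) (A r) k)

      D-+ˡ : ∀ v v′ w → D (λ r → v r + v′ r) w ≈ D v w + D v′ w
      D-+ˡ v v′ w = trans (D-comm _ w) (trans (det-setColumn-+ (setColumn A q w) p v v′)
                      (sym (+-cong (D-comm v w) (D-comm v′ w))))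

      D-alternating : ∀ v → D v v ≈ 0#
      D-alternating v = det-adjacent-equal a (setColumn (setColumn A p v) q v) λ r → reflexive
        (≡.trans (setColumn-off (setColumn A p v) q v r p≢q)
          (≡.trans (setColumn-at A p v r) (≡.sym (setColumn-at (setColumn A p v) q v r))))

    -- Polarisation: expanding `D (v + w) (v + w)`, which is zero, by additivity in both columns
    -- leaves `D v w` after the two alternating terms and `D w v` vanish.
    det-swap-zero : ∀ v w → D w v ≈ 0# → D v w ≈ 0#
    det-swap-zero v w Dwv≈0 = begin
      D v w
        ≈⟨ sym (trans (+-cong (+-identityˡ _) (+-identityˡ _)) (+-identityʳ _)) ⟩
      (0# + D v w) + (0# + 0#)
        ≈⟨ sym (+-cong (+-congʳ (D-alternating v)) (+-cong Dwv≈0 (D-alternating w))) ⟩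
      (D v v + D v w) + (D w v + D w w)
        ≈⟨ sym (+-cong (D-+ʳ v v w) (D-+ʳ w v w)) ⟩
      D v (λ r → v r + w r) + D w (λ r → v r + w r)
        ≈⟨ sym (D-+ˡ v w _) ⟩
      D (λ r → v r + w r) (λ r → v r + w r)
        ≈⟨ D-alternating _ ⟩
      0# ∎

  -- Swapping columns `p` and `m` brings the column equal to that of `q` one step closer to `q`.
  -- Induction along the chain ends with adjacent equal columns.
  det-before-equal : {p q : Fin n} → Before p q → (A : Matrix Carrier n) →
                     (∀ r → A r p ≈ A r q) → det A ≈ 0#
  det-before-equal (next a) A eq = det-adjacent-equal a A eq
  det-before-equal {p = p} {q} (skip {m = m} a b) A eq =
    trans (det-cong unchanged) (det-swap-zero a A Aₚ Aₘ (det-before-equal b swapped eq′))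
    where
    Aₚ Aₘ : Vector Carrier _
    Aₚ r = A r p
    Aₘ r = A r m
    swapped : Matrix Carrier _
    swapped = setColumn (setColumn A p Aₘ) m Aₚ
    q≢m : q ≢ m
    q≢m ≡.refl = Before-irrefl b
    q≢p : q ≢ p
    q≢p ≡.refl = Before-irrefl (skip a b)
    eq′ : ∀ r → swapped r m ≈ swapped r q
    eq′ r = trans (reflexive (setColumn-at (setColumn A p Aₘ) m Aₚ r))
      (trans (eq r) (reflexive (≡.sym
        (≡.trans (setColumn-off (setColumn A p Aₘ) m Aₚ r q≢m) (setColumn-off A p Aₘ r q≢p)))))
    -- Overwriting two columns of `A` with themselves puts it into the form to which `det-swap-zero`
    -- applies.
    unchanged : ∀ r k → A r k ≈ setColumn (setColumn A p Aₚ) m Aₘ r k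
    unchanged r k with k ≟ m
    ... | yes ≡.refl = reflexive (≡.sym (setColumn-at (setColumn A p Aₚ) m Aₘ r))
    ... | no k≢m with k ≟ p
    ...   | yes ≡.refl = reflexive (≡.sym (≡.trans
              (setColumn-off (setColumn A p Aₚ) m Aₘ r k≢m) (setColumn-at A p Aₚ r)))
    ...   | no k≢p = reflexive (≡.sym (≡.trans
              (setColumn-off (setColumn A p Aₚ) m Aₘ r k≢m) (setColumn-off A p Aₚ r k≢p)))

  det-equal-columns : (A : Matrix Carrier n) {p q : Fin n} → p ≢ q →
                      (∀ r → A r p ≈ A r q) → det A ≈ 0#
  det-equal-columns A {p} {q} p≢q eq with ≢⇒Before p q p≢q
  ... | inj₁ b = det-before-equal b A eq
  ... | inj₂ b = det-before-equal b A (sym ∘ eq)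

  -- `C` is row `j` of the adjugate. Pairing it with column `k` expands the determinant of `A` with
  -- column `j` replaced by column `k`, a matrix with two equal columns unless `k` is `j`.
  adjugate-row : (A : Matrix Carrier n) (j : Fin n) →
    ∃ λ (C : Vector Carrier n) →
      (sum (λ r → A r j * C r) ≈ det A) ×
      (∀ k → k ≢ j → sum (λ r → A r k * C r) ≈ 0#)
  adjugate-row A j =
    proj₁ (det-linear A j) , sym (proj₂ (det-linear A j) A λ _ _ _ → refl) , other
    where
    other : ∀ k → k ≢ j → sum (λ r → A r k * proj₁ (det-linear A j) r) ≈ 0#
    other k k≢j = trans (sym (det-setColumn A j Aₖ))
      (det-equal-columns (setColumn A j Aₖ) k≢j λ r → reflexive
        (≡.trans (setColumn-off A j Aₖ r k≢j) (≡.sym (setColumn-at A j Aₖ r))))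
      where
      Aₖ : Vector Carrier _
      Aₖ r = A r k

-- The action of polynomials in a square integer matrix

open import Data.Integer.Base using (-_; _+_; _*_; _≤_; +≤+)
open ≡ using (refl; sym; trans; cong₂; subst; subst₂; _≗_; module ≡-Reasoning)
open RawSemiringDefs (RawRing.rawSemiring polyRawRing) using () renaming (sum to sumᴾ)
open SemiringSum ℤ.+-*-semiring
  using (sum; sum-cong-≗; sum-replicate-zero; ∑-distrib-+; ∑-comm; *-distribˡ-sum; *-distribʳ-sum)

-- Serves both as the identity matrix and as the standard basis, `δ i` being the `i`-th basis
-- vector.
δ : Fin n → Fin n → ℤ
δ i j = if does (i ≟ j) then 1ℤ else 0ℤ

sum-zero : {f : Vector ℤ n} → (∀ i → f i ≡ 0ℤ) → sum f ≡ 0ℤ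
sum-zero {n = n} f≡0 = trans (sum-cong-≗ f≡0) (sum-replicate-zero n)

sum-single : (f : Vector ℤ n) (j : Fin n) → (∀ k → k ≢ j → f k ≡ 0ℤ) → sum f ≡ f j
sum-single f zero    rest≡0 =
  trans (cong (f zero +_) (sum-zero λ k → rest≡0 (suc k) λ ())) (ℤ.+-identityʳ _)
sum-single f (suc j) rest≡0 =
  trans (cong₂ _+_ (rest≡0 zero λ ()) (sum-single (f ∘ suc) j λ k k≢j → rest≡0 (suc k) (k≢j ∘ suc-injective)))
    (ℤ.+-identityˡ _)

δ-diagonal : (i : Fin n) → δ i i ≡ 1ℤ
δ-diagonal zero    = refl
δ-diagonal (suc i) = δ-diagonal i

δ-off-diagonal : {i j : Fin n} → i ≢ j → δ i j ≡ 0ℤ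
δ-off-diagonal {i = i} {j} i≢j with i ≟ j
... | yes i≡j with () ← i≢j i≡j
... | no  _   = refl

δ-sym : (i j : Fin n) → δ i j ≡ δ j i
δ-sym zero    zero    = refl
δ-sym zero    (suc j) = refl
δ-sym (suc i) zero    = refl
δ-sym (suc i) (suc j) = δ-sym i j

sum-δ : (f : Vector ℤ n) (i : Fin n) → sum (λ j → f j * δ i j) ≡ f i
sum-δ f i = trans
  (sum-single _ i λ j j≢i → trans (cong (f j *_) (δ-off-diagonal (j≢i ∘ sym))) (ℤ.*-zeroʳ (f j)))
  (trans (cong (f i *_) (δ-diagonal i)) (ℤ.*-identityʳ (f i)))

module PolynomialAction (S : Matrix ℤ n) where

  mul : Vector ℤ n → Vector ℤ n
  mul v i = sum λ j → S i j * v j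

  mul-cong : {v w : Vector ℤ n} → v ≗ w → mul v ≗ mul w
  mul-cong v≗w i = sum-cong-≗ λ j → cong (S i j *_) (v≗w j)

  mul-+ : (v w : Vector ℤ n) → mul (λ i → v i + w i) ≗ (λ i → mul v i + mul w i)
  mul-+ v w i = trans (sum-cong-≗ λ j → ℤ.*-distribˡ-+ (S i j) (v j) (w j))
                      (∑-distrib-+ (λ j → S i j * v j) (λ j → S i j * w j))

  mul-* : (c : ℤ) (v : Vector ℤ n) → mul (λ i → c * v i) ≗ (λ i → c * mul v i)
  mul-* c v i = trans (sum-cong-≗ λ j → exchange (S i j) c (v j))
                      (sym (*-distribˡ-sum c (λ j → S i j * v j)))
    where
    exchange : ∀ s c x → s * (c * x) ≡ c * (s * x)
    exchange = solve-∀

  mul-0 : mul (λ _ → 0ℤ) ≗ (λ _ → 0ℤ)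
  mul-0 i = sum-zero λ j → ℤ.*-zeroʳ (S i j)

  mul-δ : ∀ i x → mul (δ i) x ≡ S x i
  mul-δ i x = sum-δ (S x) i

  -- The vector p(S) v in Horner form, which avoids matrix powers and makes induction on the
  -- coefficients direct.
  act : Poly → Vector ℤ n → Vector ℤ n
  act []      v i = 0ℤ
  act (a ∷ p) v i = a * v i + mul (act p v) i

  act-cong : ∀ p {v w} → v ≗ w → act p v ≗ act p w
  act-cong []      v≗w i = refl
  act-cong (a ∷ p) v≗w i = cong₂ _+_ (cong (a *_) (v≗w i)) (mul-cong (act-cong p v≗w) i)

  act-zero : ∀ p → act p (λ _ → 0ℤ) ≗ (λ _ → 0ℤ)
  act-zero []      i = refl
  act-zero (a ∷ p) i = cong₂ _+_ (ℤ.*-zeroʳ a) (trans (mul-cong (act-zero p) i) (mul-0 i))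

  act-+ᵛ : ∀ p v w → act p (λ i → v i + w i) ≗ (λ i → act p v i + act p w i)
  act-+ᵛ []      v w i = refl
  act-+ᵛ (a ∷ p) v w i = trans
    (cong (a * (v i + w i) +_) (trans (mul-cong (act-+ᵛ p v w) i) (mul-+ (act p v) (act p w) i)))
    (regroup a (v i) (w i) (mul (act p v) i) (mul (act p w) i))
    where
    regroup : ∀ a x y s t → a * (x + y) + (s + t) ≡ (a * x + s) + (a * y + t)
    regroup = solve-∀

  act-*ᵛ : ∀ p c v → act p (λ i → c * v i) ≗ (λ i → c * act p v i)
  act-*ᵛ []      c v i = sym (ℤ.*-zeroʳ c)
  act-*ᵛ (a ∷ p) c v i = trans
    (cong (a * (c * v i) +_) (trans (mul-cong (act-*ᵛ p c v) i) (mul-* c (act p v) i)))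
    (regroup a c (v i) (mul (act p v) i))
    where
    regroup : ∀ a c x s → a * (c * x) + c * s ≡ c * (a * x + s)
    regroup = solve-∀

  act-∑ᵛ : ∀ p {m} (v : Fin m → Vector ℤ n) →
           act p (λ i → sum λ k → v k i) ≗ (λ i → sum λ k → act p (v k) i)
  act-∑ᵛ p {zero}  v i = act-zero p i
  act-∑ᵛ p {suc m} v i = trans (act-+ᵛ p (v zero) _ i)
    (cong (act p (v zero) i +_) (act-∑ᵛ p (v ∘ suc) i))

  act-mul : ∀ p v → act p (mul v) ≗ mul (act p v)
  act-mul []      v i = sym (mul-0 i)
  act-mul (a ∷ p) v i = sym (trans (mul-+ (λ j → a * v j) (mul (act p v)) i)
    (cong₂ _+_ (mul-* a v i) (mul-cong (sym ∘ act-mul p v) i)))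

  act-+ : ∀ p q v → act (p +ᴾ q) v ≗ (λ i → act p v i + act q v i)
  act-+ []      q       v i = sym (ℤ.+-identityˡ _)
  act-+ (a ∷ p) []      v i = sym (ℤ.+-identityʳ _)
  act-+ (a ∷ p) (b ∷ q) v i = trans
    (cong ((a + b) * v i +_) (trans (mul-cong (act-+ p q v) i) (mul-+ (act p v) (act q v) i)))
    (regroup a b (v i) (mul (act p v) i) (mul (act q v) i))
    where
    regroup : ∀ a b x s t → (a + b) * x + (s + t) ≡ (a * x + s) + (b * x + t)
    regroup = solve-∀

  act-map-* : ∀ c q v → act (List.map (c *_) q) v ≗ (λ i → c * act q v i)
  act-map-* c []      v i = sym (ℤ.*-zeroʳ c)
  act-map-* c (a ∷ q) v i = trans
    (cong (c * a * v i +_) (trans (mul-cong (act-map-* c q v) i) (mul-* c (act q v) i)))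
    (regroup a c (v i) (mul (act q v) i))
    where
    regroup : ∀ a c x s → c * a * x + c * s ≡ c * (a * x + s)
    regroup = solve-∀

  act-neg : ∀ p v → act (-ᴾ p) v ≗ (λ i → - act p v i)
  act-neg []      v i = refl
  act-neg (a ∷ p) v i = trans
    (cong (- a * v i +_) (trans (mul-cong neg i) (mul-* -1ℤ (act p v) i)))
    (regroup a (v i) (mul (act p v) i))
    where
    neg : act (-ᴾ p) v ≗ (λ j → -1ℤ * act p v j)
    neg j = trans (act-neg p v j) (sym (ℤ.-1*i≡-i _))
    regroup : ∀ a x s → - a * x + - 1ℤ * s ≡ - (a * x + s)
    regroup = solve-∀

  act-* : ∀ p q v → act (p *ᴾ q) v ≗ act p (act q v)
  act-* []      q v i = refl
  act-* (a ∷ p) q v i = trans (act-+ (List.map (a *_) q) (0ℤ ∷ (p *ᴾ q)) v i)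
    (cong₂ _+_ (act-map-* a q v i)
      (trans (ℤ.+-identityˡ _) (mul-cong (act-* p q v) i)))

  act-comm : ∀ p q v → act p (act q v) ≗ act q (act p v)
  act-comm []      q v i = sym (act-zero q i)
  act-comm (a ∷ p) q v i = sym (trans (act-+ᵛ q (λ j → a * v j) (mul (act p v)) i)
    (cong₂ _+_ (act-*ᵛ q a v i)
      (trans (act-mul q (act p v) i) (mul-cong (sym ∘ act-comm p q v) i))))

  act-const : ∀ a v → act (constᴾ a) v ≗ (λ i → a * v i)
  act-const a v i = trans (cong (a * v i +_) (mul-0 i)) (ℤ.+-identityʳ _)

  act-X : ∀ v → act X v ≗ mul v
  act-X v i = trans (ℤ.+-identityˡ _)
    (mul-cong (λ j → trans (act-const 1ℤ v j) (ℤ.*-identityˡ _)) i)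

  act-≈0 : ∀ p → (∀ k → coeff p k ≡ 0ℤ) → ∀ v → act p v ≗ (λ _ → 0ℤ)
  act-≈0 []      p≈0 v i = refl
  act-≈0 (a ∷ p) p≈0 v i = cong₂ _+_ (cong (_* v i) (p≈0 0))
    (trans (mul-cong (act-≈0 p (p≈0 ∘ suc) v) i) (mul-0 i))

  act-≈ᴾ : ∀ p q → p ≈ᴾ q → ∀ v → act p v ≗ act q v
  act-≈ᴾ []      q       p≈q v i = sym (act-≈0 q (sym ∘ p≈q) v i)
  act-≈ᴾ (a ∷ p) []      p≈q v i = act-≈0 (a ∷ p) p≈q v i
  act-≈ᴾ (a ∷ p) (b ∷ q) p≈q v i = cong₂ _+_ (cong (_* v i) (p≈q 0))
    (mul-cong (act-≈ᴾ p q (p≈q ∘ suc) v) i)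

  -- The commutative ring of polynomials up to their action

  infix 4 _∼_

  -- The quotient by this relation is the ring ℤ[S]. As a record type it keeps `p` and `q`
  -- recoverable by unification.
  record _∼_ (p q : Poly) : Set where
    constructor same-action
    field
      action : ∀ v → act p v ≗ act q v

  open _∼_ public

  -- Under `act` sums become pointwise sums and products become compositions, so each law reduces to
  -- one about operators. Products commute because both factors are polynomials in the same matrix.
  isCommutativeRing : IsCommutativeRing _∼_ _+ᴾ_ _*ᴾ_ -ᴾ_ [] (1ℤ ∷ [])
  isCommutativeRing = record
    { isRing = record
      { +-isAbelianGroup = record
        { isGroup = record
          { isMonoid = record
            { isSemigroup = record
              { isMagma = record
                { isEquivalence = record
                  { refl  = same-action λ v i → refl
                  ; sym   = λ p∼q → same-action λ v i → sym (action p∼q v i)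
                  ; trans = λ p∼q q∼r → same-action λ v i → trans (action p∼q v i) (action q∼r v i)
                  }
                ; ∙-cong = λ {p} {p′} {q} {q′} p∼p′ q∼q′ → same-action λ v i →
                    trans (act-+ p q v i)
                      (trans (cong₂ _+_ (action p∼p′ v i) (action q∼q′ v i)) (sym (act-+ p′ q′ v i)))
                }
              ; assoc = λ p q r → same-action λ v i →
                  trans (trans (act-+ (p +ᴾ q) r v i) (cong (_+ act r v i) (act-+ p q v i)))
                    (trans (ℤ.+-assoc (act p v i) (act q v i) (act r v i))
                      (sym (trans (act-+ p (q +ᴾ r) v i) (cong (act p v i +_) (act-+ q r v i)))))
              }
            ; identity = (λ p → same-action λ v i → refl)
                       , (λ p → same-action λ v i → trans (act-+ p [] v i) (ℤ.+-identityʳ _))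
            }
          ; inverse = (λ p → same-action λ v i → trans (act-+ (-ᴾ p) p v i)
                        (trans (cong (_+ act p v i) (act-neg p v i)) (ℤ.+-inverseˡ (act p v i))))
                    , (λ p → same-action λ v i → trans (act-+ p (-ᴾ p) v i)
                        (trans (cong (act p v i +_) (act-neg p v i)) (ℤ.+-inverseʳ (act p v i))))
          ; ⁻¹-cong = λ {p} {q} p∼q → same-action λ v i →
              trans (act-neg p v i) (trans (cong -_ (action p∼q v i)) (sym (act-neg q v i)))
          }
        ; comm = λ p q → same-action λ v i → trans (act-+ p q v i)
            (trans (ℤ.+-comm (act p v i) (act q v i)) (sym (act-+ q p v i)))
        }
      ; *-cong = λ {p} {p′} {q} {q′} p∼p′ q∼q′ → same-action λ v i →
          trans (act-* p q v i) (trans (act-cong p (action q∼q′ v) i)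
            (trans (action p∼p′ (act q′ v) i) (sym (act-* p′ q′ v i))))
      ; *-assoc = λ p q r → same-action λ v i →
          trans (trans (act-* (p *ᴾ q) r v i) (act-* p q (act r v) i))
            (sym (trans (act-* p (q *ᴾ r) v i) (act-cong p (act-* q r v) i)))
      ; *-identity = (λ p → same-action λ v i → trans (act-* (1ℤ ∷ []) p v i) (act-1 (act p v) i))
                   , (λ p → same-action λ v i → trans (act-* p (1ℤ ∷ []) v i) (act-cong p (act-1 v) i))
      ; distrib = (λ p q r → same-action λ v i →
                    trans (trans (act-* p (q +ᴾ r) v i) (trans (act-cong p (act-+ q r v) i) (act-+ᵛ p (act q v) (act r v) i)))
                      (sym (trans (act-+ (p *ᴾ q) (p *ᴾ r) v i) (cong₂ _+_ (act-* p q v i) (act-* p r v i)))))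
                , (λ p q r → same-action λ v i →
                    trans (trans (act-* (q +ᴾ r) p v i) (act-+ q r (act p v) i))
                      (sym (trans (act-+ (q *ᴾ p) (r *ᴾ p) v i) (cong₂ _+_ (act-* q p v i) (act-* r p v i)))))
      }
    ; *-comm = λ p q → same-action λ v i →
        trans (act-* p q v i) (trans (act-comm p q v i) (sym (act-* q p v i)))
    }
    where
    act-1 : ∀ v → act (1ℤ ∷ []) v ≗ v
    act-1 v i = trans (act-const 1ℤ v i) (ℤ.*-identityˡ _)

  act-sumᴾ : ∀ {m} (p : Vector Poly m) v → act (sumᴾ p) v ≗ (λ i → sum λ k → act (p k) v i)
  act-sumᴾ {zero}  p v i = refl
  act-sumᴾ {suc m} p v i = trans (act-+ (p zero) (sumᴾ (p ∘ suc)) v i)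
    (cong (act (p zero) v i +_) (act-sumᴾ (p ∘ suc) v i))

  -- The Cayley-Hamilton theorem for symmetric matrices

  characteristicMatrix : Matrix Poly n
  characteristicMatrix i j = (if does (i ≟ j) then X else []) +ᴾ (-ᴾ constᴾ (S i j))

  act-characteristicMatrix : ∀ i k v x →
    act (characteristicMatrix i k) v x ≡ mul v x * δ i k + - (S i k * v x)
  act-characteristicMatrix i k v x = trans
    (act-+ (if does (i ≟ k) then X else []) (-ᴾ constᴾ (S i k)) v x)
    (cong₂ _+_ (act-if (does (i ≟ k)))
      (trans (act-neg (constᴾ (S i k)) v x) (cong -_ (act-const (S i k) v x))))
    where
    act-if : ∀ b → act (if b then X else []) v x ≡ mul v x * (if b then 1ℤ else 0ℤ)
    act-if true  = trans (act-X v x) (sym (ℤ.*-identityʳ _))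
    act-if false = sym (ℤ.*-zeroʳ (mul v x))

  module _ (symmetric : ∀ i j → S i j ≡ S j i) where

    -- Row `i` of X I - S sends the basis vectors to S δᵢ minus the combination of the δₖ with
    -- coefficients Sᵢₖ, that is, to column `i` of S minus row `i`. Symmetry makes these equal.
    characteristicMatrix-kills : ∀ i x → sum (λ k → act (characteristicMatrix i k) (δ k) x) ≡ 0ℤ
    characteristicMatrix-kills i x = begin
      sum (λ k → act (characteristicMatrix i k) (δ k) x)
        ≡⟨ sum-cong-≗ (λ k → act-characteristicMatrix i k (δ k) x) ⟩
      sum (λ k → mul (δ k) x * δ i k + - (S i k * δ k x))
        ≡⟨ ∑-distrib-+ (λ k → mul (δ k) x * δ i k) (λ k → - (S i k * δ k x)) ⟩
      sum (λ k → mul (δ k) x * δ i k) + sum (λ k → - (S i k * δ k x))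
        ≡⟨ cong₂ _+_ (sum-δ (λ k → mul (δ k) x) i) (sum-cong-≗ neg) ⟩
      mul (δ i) x + sum (λ k → - S i k * δ x k)
        ≡⟨ cong₂ _+_ (mul-δ i x) (sum-δ (λ k → - S i k) x) ⟩
      S x i + - S i x
        ≡⟨ cong (_+ - S i x) (symmetric x i) ⟩
      S i x + - S i x
        ≡⟨ ℤ.+-inverseʳ (S i x) ⟩
      0ℤ ∎
      where
      open ≡-Reasoning
      neg : ∀ k → - (S i k * δ k x) ≡ - S i k * δ x k
      neg k = trans (ℤ.neg-distribˡ-* (S i k) (δ k x)) (cong (- S i k *_) (δ-sym k x))

    -- The determinant trick: x I - S annihilates the vector (δ k)ₖ of basis
    -- vectors, hence so does the product of its determinant with each entry.
    cayley-hamilton : ∀ j → act (charPoly S) (δ j) ≗ (λ _ → 0ℤ)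
    cayley-hamilton j x = begin
      act (charPoly S) (δ j) x
        ≡⟨ sym (action (proj₁ (proj₂ adj)) (δ j) x) ⟩
      act (sumᴾ (λ r → M r j *ᴾ C r)) (δ j) x
        -- The sum over all `k` adds only zeros, since row `j` of the adjugate is orthogonal to
        -- every other column of `M`.
        ≡⟨ sym (sum-single (λ k → act (sumᴾ (λ r → M r k *ᴾ C r)) (δ k) x) j λ k k≢j →
             action (proj₂ (proj₂ adj) k k≢j) (δ k) x) ⟩
      sum (λ k → act (sumᴾ (λ r → M r k *ᴾ C r)) (δ k) x)
        ≡⟨ sum-cong-≗ (λ k → trans (act-sumᴾ (λ r → M r k *ᴾ C r) (δ k) x) (sum-cong-≗ λ r →
             trans (act-* (M r k) (C r) (δ k) x) (act-comm (M r k) (C r) (δ k) x))) ⟩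
      sum (λ k → sum λ r → act (C r) (act (M r k) (δ k)) x)
        ≡⟨ ∑-comm (λ k r → act (C r) (act (M r k) (δ k)) x) ⟩
      sum (λ r → sum λ k → act (C r) (act (M r k) (δ k)) x)
        -- Once `C r` is pulled out of the sum over `k`, what remains inside is row `r` of `M`
        -- applied to the basis vectors.
        ≡⟨ sum-zero (λ r → trans (sym (act-∑ᵛ (C r) (λ k → act (M r k) (δ k)) x))
             (trans (act-cong (C r) (characteristicMatrix-kills r) x) (act-zero (C r) x))) ⟩
      0ℤ ∎
      where
      open ≡-Reasoning
      open DeterminantTheory polyRawRing isCommutativeRing using (adjugate-row)
      M = characteristicMatrix
      adj = adjugate-row M j
      C = proj₁ adj

-- Symmetric matrices with the given spectrum

0≤i*i : ∀ i → 0ℤ ≤ i * i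
0≤i*i (ℤ.+ m)      = subst (0ℤ ≤_) (ℤ.pos-* m m) (+≤+ z≤n)
0≤i*i ℤ.-[1+ m ] = +≤+ z≤n

i*i≡0⇒i≡0 : ∀ i → i * i ≡ 0ℤ → i ≡ 0ℤ
i*i≡0⇒i≡0 i = reduce ∘ ℤ.i*j≡0⇒i≡0∨j≡0 i

sum-nonneg : {f : Vector ℤ n} → (∀ i → 0ℤ ≤ f i) → 0ℤ ≤ sum f
sum-nonneg {n = zero}  0≤f = ℤ.≤-refl
sum-nonneg {n = suc n} 0≤f = ℤ.+-mono-≤ (0≤f zero) (sum-nonneg (0≤f ∘ suc))

sum-nonneg-≡0 : {f : Vector ℤ n} → (∀ i → 0ℤ ≤ f i) → sum f ≡ 0ℤ → ∀ i → f i ≡ 0ℤ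
sum-nonneg-≡0 {n = suc n} {f} 0≤f ∑f≡0 = λ where
    zero    → f₀≡0
    (suc i) → sum-nonneg-≡0 (0≤f ∘ suc)
      (trans (sym (ℤ.+-identityˡ _)) (trans (cong (_+ sum (f ∘ suc)) (sym f₀≡0)) ∑f≡0)) i
  where
  f₀≡0 : f zero ≡ 0ℤ
  f₀≡0 = ℤ.≤-antisym
    (subst₂ _≤_ (ℤ.+-identityʳ (f zero)) ∑f≡0 (ℤ.+-monoʳ-≤ (f zero) (sum-nonneg (0≤f ∘ suc))))
    (0≤f zero)

-- Inner products and self-adjointness

⟨_,_⟩ : Vector ℤ n → Vector ℤ n → ℤ
⟨ u , v ⟩ = sum λ i → u i * v i

⟨⟩-comm : (u v : Vector ℤ n) → ⟨ u , v ⟩ ≡ ⟨ v , u ⟩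
⟨⟩-comm u v = sum-cong-≗ λ i → ℤ.*-comm (u i) (v i)

⟨⟩-congʳ : (u : Vector ℤ n) {v w : Vector ℤ n} → v ≗ w → ⟨ u , v ⟩ ≡ ⟨ u , w ⟩
⟨⟩-congʳ u v≗w = sum-cong-≗ λ i → cong (u i *_) (v≗w i)

⟨⟩-+ʳ : (u v w : Vector ℤ n) → ⟨ u , (λ i → v i + w i) ⟩ ≡ ⟨ u , v ⟩ + ⟨ u , w ⟩
⟨⟩-+ʳ u v w = trans (sum-cong-≗ λ i → ℤ.*-distribˡ-+ (u i) (v i) (w i))
  (∑-distrib-+ (λ i → u i * v i) (λ i → u i * w i))

⟨⟩-*ʳ : (u : Vector ℤ n) (c : ℤ) (v : Vector ℤ n) → ⟨ u , (λ i → c * v i) ⟩ ≡ c * ⟨ u , v ⟩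
⟨⟩-*ʳ u c v = trans (sum-cong-≗ λ i → exchange (u i) c (v i))
  (sym (*-distribˡ-sum c (λ i → u i * v i)))
  where
  exchange : ∀ x c y → x * (c * y) ≡ c * (x * y)
  exchange = solve-∀

⟨⟩-0ʳ : (u : Vector ℤ n) → ⟨ u , (λ _ → 0ℤ) ⟩ ≡ 0ℤ
⟨⟩-0ʳ u = sum-zero λ i → ℤ.*-zeroʳ (u i)

square : Poly → Poly
square p = p *ᴾ p

roots : List ℤ → Poly
roots λs = productᴾ (List.map (λ μ → X +ᴾ (-ᴾ constᴾ μ)) λs)

module SelfAdjoint (S : Matrix ℤ n) (symmetric : ∀ i j → S i j ≡ S j i) where

  open PolynomialAction S

  mul-self-adjoint : ∀ u v → ⟨ mul u , v ⟩ ≡ ⟨ u , mul v ⟩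
  mul-self-adjoint u v = begin
    sum (λ i → sum (λ j → S i j * u j) * v i)
      ≡⟨ sum-cong-≗ (λ i → *-distribʳ-sum (v i) (λ j → S i j * u j)) ⟩
    sum (λ i → sum λ j → S i j * u j * v i)
      ≡⟨ ∑-comm (λ i j → S i j * u j * v i) ⟩
    sum (λ j → sum λ i → S i j * u j * v i)
      ≡⟨ sum-cong-≗ (λ j → sum-cong-≗ λ i →
           trans (cong (λ s → s * u j * v i) (symmetric i j)) (exchange (S j i) (u j) (v i))) ⟩
    sum (λ j → sum λ i → u j * (S j i * v i))
      ≡⟨ sum-cong-≗ (λ j → sym (*-distribˡ-sum (u j) (λ i → S j i * v i))) ⟩
    sum (λ j → u j * sum (λ i → S j i * v i)) ∎
    where
    open ≡-Reasoning
    exchange : ∀ s x y → s * x * y ≡ x * (s * y)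
    exchange = solve-∀

  act-self-adjoint : ∀ p u v → ⟨ act p u , v ⟩ ≡ ⟨ u , act p v ⟩
  act-self-adjoint []      u v = trans (sum-zero {f = λ i → 0ℤ * v i} λ i → refl) (sym (⟨⟩-0ʳ u))
  act-self-adjoint (a ∷ p) u v = begin
    ⟨ act (a ∷ p) u , v ⟩
      ≡⟨ ⟨⟩-comm (act (a ∷ p) u) v ⟩
    ⟨ v , act (a ∷ p) u ⟩
      ≡⟨ trans (⟨⟩-+ʳ v (λ i → a * u i) (mul (act p u))) (cong (_+ ⟨ v , mul (act p u) ⟩) (⟨⟩-*ʳ v a u)) ⟩
    a * ⟨ v , u ⟩ + ⟨ v , mul (act p u) ⟩
      ≡⟨ cong₂ _+_ (cong (a *_) (⟨⟩-comm v u)) swap ⟩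
    a * ⟨ u , v ⟩ + ⟨ u , mul (act p v) ⟩
      ≡⟨ sym (trans (⟨⟩-+ʳ u (λ i → a * v i) (mul (act p v))) (cong (_+ ⟨ u , mul (act p v) ⟩) (⟨⟩-*ʳ u a v))) ⟩
    ⟨ u , act (a ∷ p) v ⟩ ∎
    where
    open ≡-Reasoning
    -- S commutes with p(S), so the induction hypothesis applies to `mul u`, and the symmetry of S
    -- moves the remaining `mul` across.
    swap : ⟨ v , mul (act p u) ⟩ ≡ ⟨ u , mul (act p v) ⟩
    swap = trans (⟨⟩-congʳ v (sym ∘ act-mul p u)) (trans (⟨⟩-comm v (act p (mul u)))
      (trans (act-self-adjoint p (mul u) v) (mul-self-adjoint u (act p v))))

  -- By self-adjointness the squared norm of p(S) v is the inner product of v with p(S)² v, which is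
  -- zero. A sum of integer squares vanishes only termwise.
  act-square-zero : ∀ p v → act (p *ᴾ p) v ≗ (λ _ → 0ℤ) → act p v ≗ (λ _ → 0ℤ)
  act-square-zero p v p²v≡0 i =
    i*i≡0⇒i≡0 (act p v i) (sum-nonneg-≡0 (λ j → 0≤i*i (act p v j)) norm≡0 i)
    where
    norm≡0 : ⟨ act p v , act p v ⟩ ≡ 0ℤ
    norm≡0 = trans (act-self-adjoint p v (act p v))
      (trans (⟨⟩-congʳ v λ j → trans (sym (act-* p p v j)) (p²v≡0 j)) (⟨⟩-0ʳ v))

  -- Four applications of `act-square-zero`. The exponent 16 is the least power of two that is at
  -- least 9, the largest multiplicity in the spectrum.
  act-16th-power-zero : ∀ p q r → square (square (square (square p))) ≡ q *ᴾ r →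
    ∀ v → act r v ≗ (λ _ → 0ℤ) → act p v ≗ (λ _ → 0ℤ)
  act-16th-power-zero p q r p¹⁶≡qr v rv≡0 =
    act-square-zero p v (act-square-zero (square p) v (act-square-zero (square (square p)) v
      (act-square-zero (square (square (square p))) v λ x →
        trans (cong (λ f → act f v x) p¹⁶≡qr)
          (trans (act-* q r v x) (trans (act-cong q rv≡0 x) (act-zero q x))))))

  roots-kill : ∀ λs → HasSpectrum S λs → ∀ j → act (roots λs) (δ j) ≗ (λ _ → 0ℤ)
  roots-kill λs hasSpectrum j x = trans
    (sym (act-≈ᴾ (charPoly S) (roots λs) (HasSpectrum.charPoly-splits hasSpectrum) (δ j) x))
    (cayley-hamilton symmetric j x)

-- The two lists together contain each of -9, 1 and 3 sixteen times.
spectrum cospectrum : List ℤ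
spectrum   = ([ - (ℤ.+ 9) ]^ 3) ++ ([ ℤ.+ 1 ]^ 9) ++ ([ ℤ.+ 3 ]^ 6)
cospectrum = ([ - (ℤ.+ 9) ]^ 13) ++ ([ ℤ.+ 1 ]^ 7) ++ ([ ℤ.+ 3 ]^ 10)

-- (X + 9)(X - 1)(X - 3)
minimalPoly : Poly
minimalPoly = ℤ.+ 27 ∷ - (ℤ.+ 33) ∷ ℤ.+ 5 ∷ 1ℤ ∷ []

minimalPoly¹⁶-factors : square (square (square (square minimalPoly))) ≡ roots cospectrum *ᴾ roots spectrum
minimalPoly¹⁶-factors =
  from-yes (≡-dec ℤ._≟_ (square (square (square (square minimalPoly)))) (roots cospectrum *ᴾ roots spectrum))

module MinimalPolynomial (S : Matrix ℤ n) (symmetric : ∀ i j → S i j ≡ S j i)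
  (hasSpectrum : HasSpectrum S spectrum) where

  open PolynomialAction S
  open SelfAdjoint S symmetric

  minimalPoly-kills : ∀ j → act minimalPoly (δ j) ≗ (λ _ → 0ℤ)
  minimalPoly-kills j =
    act-16th-power-zero minimalPoly (roots cospectrum) (roots spectrum) minimalPoly¹⁶-factors
      (δ j) (roots-kill spectrum hasSpectrum j)

-- Positive triangles

IsSign : ℤ → Set
IsSign x = x ≡ 1ℤ ⊎ x ≡ -1ℤ

-- Nested, this decides a claim about several signs by evaluating every combination. The claims
-- below interleave each variable with its sign hypothesis to fit this shape.
all-signs? : {P : ℤ → Set} → (∀ x → Dec (P x)) → Dec (∀ x → IsSign x → P x)
all-signs? {P} P? = map′ to (λ all → all 1ℤ (inj₁ refl) , all -1ℤ (inj₂ refl)) (P? 1ℤ ×-dec P? -1ℤ)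
  where
  to : P 1ℤ × P -1ℤ → ∀ x → IsSign x → P x
  to (p , _) _ (inj₁ refl) = p
  to (_ , p) _ (inj₂ refl) = p

-- a, b, c are the entries of a Seidel matrix at the edges ij, jk, ik of a
-- triangle and x, y, z those at il, jl, kl.
quadrupleTerm : (a b c x y z d : ℤ) → ℤ
quadrupleTerm a b c x y z d =
  (a * b * c * (a * b * c) + a * b * c) * ((a * x * y + b * y * z + c * x * z) + (1ℤ + - (ℤ.+ 2) * d))

-- The first factor is 2 if abc = 1 and 0 if abc = -1. In the former case the other three triangles
-- have signs with product abc(xyz)² = 1, so p = 1 or 3 of them are positive, and the second factor
-- is 2p - 2.
quadrupleTerm-distinct : ∀ a → IsSign a → ∀ b → IsSign b → ∀ c → IsSign c →
  ∀ x → IsSign x → ∀ y → IsSign y → ∀ z → IsSign z → 0ℤ ≤ quadrupleTerm a b c x y z 0ℤ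
quadrupleTerm-distinct = from-yes
  (all-signs? λ a → all-signs? λ b → all-signs? λ c → all-signs? λ x → all-signs? λ y → all-signs? λ z →
    0ℤ ℤ.≤? quadrupleTerm a b c x y z 0ℤ)

-- The case l = i: of the three products only abc survives, and the correction is 1 - 2 = -1, so a
-- positive triangle contributes exactly 0. The cases l = j and l = k are alike.
quadrupleTerm-i : ∀ a → IsSign a → ∀ b → IsSign b → ∀ c → IsSign c → 0ℤ ≤ quadrupleTerm a b c 0ℤ a c 1ℤ
quadrupleTerm-i = from-yes (all-signs? λ a → all-signs? λ b → all-signs? λ c →
  0ℤ ℤ.≤? quadrupleTerm a b c 0ℤ a c 1ℤ)

quadrupleTerm-j : ∀ a → IsSign a → ∀ b → IsSign b → ∀ c → IsSign c → 0ℤ ≤ quadrupleTerm a b c a 0ℤ b 1ℤ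
quadrupleTerm-j = from-yes (all-signs? λ a → all-signs? λ b → all-signs? λ c →
  0ℤ ℤ.≤? quadrupleTerm a b c a 0ℤ b 1ℤ)

quadrupleTerm-k : ∀ a → IsSign a → ∀ b → IsSign b → ∀ c → IsSign c → 0ℤ ≤ quadrupleTerm a b c c b 0ℤ 1ℤ
quadrupleTerm-k = from-yes (all-signs? λ a → all-signs? λ b → all-signs? λ c →
  0ℤ ℤ.≤? quadrupleTerm a b c c b 0ℤ 1ℤ)

sum-1 : ∀ n → sum {n} (λ _ → 1ℤ) ≡ ℤ.+ n
sum-1 zero    = refl
sum-1 (suc n) = cong (1ℤ +_) (sum-1 n)

-- Sums over ordered triples

∑³ : (Fin n → Fin n → Fin n → ℤ) → ℤ
∑³ g = sum λ i → sum λ j → sum λ k → g i j k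

∑³-cong : {g h : Fin n → Fin n → Fin n → ℤ} → (∀ i j k → g i j k ≡ h i j k) → ∑³ g ≡ ∑³ h
∑³-cong g≡h = sum-cong-≗ λ i → sum-cong-≗ λ j → sum-cong-≗ λ k → g≡h i j k

∑³-+ : (g h : Fin n → Fin n → Fin n → ℤ) → ∑³ (λ i j k → g i j k + h i j k) ≡ ∑³ g + ∑³ h
∑³-+ g h = trans
  (sum-cong-≗ λ i → trans (sum-cong-≗ λ j → ∑-distrib-+ (g i j) (h i j))
    (∑-distrib-+ (λ j → sum (g i j)) (λ j → sum (h i j))))
  (∑-distrib-+ (λ i → sum λ j → sum (g i j)) (λ i → sum λ j → sum (h i j)))

∑³-swap : (g : Fin n → Fin n → Fin n → ℤ) → ∑³ (λ i j k → g i k j) ≡ ∑³ g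
∑³-swap g = sum-cong-≗ λ i → ∑-comm (λ j k → g i k j)

∑³-rotate : (g : Fin n → Fin n → Fin n → ℤ) → ∑³ (λ i j k → g j k i) ≡ ∑³ g
∑³-rotate g = trans (∑-comm (λ i j → sum λ k → g j k i)) (∑³-swap g)

-- As `w` is invariant under all permutations of its indices, renaming them shows that the three `e`
-- terms contribute equally, whence the factor 3.
∑³-edges : (w : Fin n → Fin n → Fin n → ℤ) (e : Fin n → Fin n → ℤ) (c : ℤ) →
  (∀ i j k → w i j k ≡ w j k i) → (∀ i j k → w i j k ≡ w i k j) →
  ∑³ (λ i j k → w i j k * (e i j + e j k + e i k + c)) ≡
  sum λ i → sum λ j → (ℤ.+ 3 * e i j + c) * sum (w i j)
∑³-edges w e c w-rotate w-swap = begin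
  ∑³ (λ i j k → w i j k * (e i j + e j k + e i k + c))
    ≡⟨ ∑³-cong (λ i j k → trans (expand (w i j k) (e i j) (e j k) (e i k) c)
         (cong₂ _+_ (cong (w i j k * (e i j + c) +_) (cong (_* e j k) (w-rotate i j k)))
           (cong (_* e i k) (w-swap i j k)))) ⟩
  ∑³ (λ i j k → w i j k * (e i j + c) + w j k i * e j k + w i k j * e i k)
    ≡⟨ trans (∑³-+ (λ i j k → w i j k * (e i j + c) + w j k i * e j k) (λ i j k → w i k j * e i k))
         (cong (_+ ∑³ (λ i j k → w i k j * e i k))
           (∑³-+ (λ i j k → w i j k * (e i j + c)) (λ i j k → w j k i * e j k))) ⟩
  ∑³ (λ i j k → w i j k * (e i j + c)) + ∑³ (λ i j k → w j k i * e j k) + ∑³ (λ i j k → w i k j * e i k)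
    ≡⟨ cong₂ (λ s t → ∑³ (λ i j k → w i j k * (e i j + c)) + s + t) (∑³-rotate we) (∑³-swap we) ⟩
  ∑³ (λ i j k → w i j k * (e i j + c)) + ∑³ we + ∑³ we
    ≡⟨ sym (trans (∑³-+ (λ i j k → w i j k * (e i j + c) + we i j k) we)
         (cong (_+ ∑³ we) (∑³-+ (λ i j k → w i j k * (e i j + c)) we))) ⟩
  ∑³ (λ i j k → w i j k * (e i j + c) + we i j k + we i j k)
    ≡⟨ sum-cong-≗ (λ i → sum-cong-≗ λ j → trans (sum-cong-≗ λ k → collect (w i j k) (e i j) c)
         (sym (*-distribˡ-sum (ℤ.+ 3 * e i j + c) (w i j)))) ⟩
  sum (λ i → sum λ j → (ℤ.+ 3 * e i j + c) * sum (w i j)) ∎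
  where
  open ≡-Reasoning
  we : Fin _ → Fin _ → Fin _ → ℤ
  we i j k = w i j k * e i j
  expand : ∀ w x y z c → w * (x + y + z + c) ≡ w * (x + c) + w * y + w * z
  expand = solve-∀
  collect : ∀ w x c → w * (x + c) + w * x + w * x ≡ (ℤ.+ 3 * x + c) * w
  collect = solve-∀

-- The triangle inequality for Seidel matrices

module SeidelInequality (S : Matrix ℤ n) (isSeidel : IsSeidel S) where

  open IsSeidel isSeidel

  square-entry : ∀ i j → S i j * S i j ≡ 1ℤ + - δ i j
  square-entry i j with i ≟ j
  ... | yes refl rewrite diagonal i = refl
  ... | no i≢j with off-diagonal i j i≢j
  ...   | inj₁ eq rewrite eq = refl
  ...   | inj₂ eq rewrite eq = refl

  -- By symmetry `q` is S². On an edge, `e` is the number of positive triangles minus that of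
  -- negative ones: 2t - (n - 2), with t positive triangles on the edge. On the diagonal it is 0.
  q e : Fin n → Fin n → ℤ
  q i j = sum λ l → S i l * S j l
  e i j = S i j * q i j

  -- `u` is the sign of a triangle, or 0 if two indices coincide. Hence `w` is 2 on positive
  -- triangles and 0 on all other triples.
  u w : Fin n → Fin n → Fin n → ℤ
  u i j k = S i j * S j k * S i k
  w i j k = u i j k * u i j k + u i j k

  w-rotate : ∀ i j k → w i j k ≡ w j k i
  w-rotate i j k = cong (λ t → t * t + t)
    (trans (perm (S i j) (S j k) (S i k)) (cong₂ (λ x y → S j k * x * y) (symmetric i k) (symmetric i j)))
    where
    perm : ∀ a b c → a * b * c ≡ b * c * a
    perm = solve-∀

  w-swap : ∀ i j k → w i j k ≡ w i k j
  w-swap i j k = cong (λ t → t * t + t)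
    (trans (perm (S i j) (S j k) (S i k)) (cong (λ x → S i k * x * S i j) (symmetric j k)))
    where
    perm : ∀ a b c → a * b * c ≡ c * b * a
    perm = solve-∀

  term : Fin n → Fin n → Fin n → Fin n → ℤ
  term i j k l = quadrupleTerm (S i j) (S j k) (S i k) (S i l) (S j l) (S k l) (δ i l + δ j l + δ k l)

  0≤degenerateTerm : ∀ i j k l → u i j k ≡ 0ℤ → 0ℤ ≤ term i j k l
  0≤degenerateTerm i j k l u≡0 rewrite u≡0 = ℤ.≤-refl

  -- An even number of the four triangles of a quadruple have entries with
  -- product 1; hence if ijk is one of them, then so is another.
  0≤term : ∀ i j k l → 0ℤ ≤ term i j k l
  0≤term i j k l with i ≟ j | j ≟ k | i ≟ k
  ... | yes refl | _ | _ = 0≤degenerateTerm i i k l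
        (cong (λ a → a * S i k * S i k) (diagonal i))
  ... | no _ | yes refl | _ = 0≤degenerateTerm i j j l
        (trans (cong (λ a → S i j * a * S i j) (diagonal j)) (cong (_* S i j) (ℤ.*-zeroʳ (S i j))))
  ... | no _ | no _ | yes refl = 0≤degenerateTerm i j i l
        (trans (cong (S i j * S j i *_) (diagonal i)) (ℤ.*-zeroʳ (S i j * S j i)))
  ... | no i≢j | no j≢k | no i≢k = distinct (i ≟ l) (j ≟ l) (k ≟ l)
    where
    a = S i j
    b = S j k
    c = S i k
    ±a = off-diagonal i j i≢j
    ±b = off-diagonal j k j≢k
    ±c = off-diagonal i k i≢k
    cong-term : ∀ {x x′ y y′ z z′ d d′} → x ≡ x′ → y ≡ y′ → z ≡ z′ → d ≡ d′ →
                0ℤ ≤ quadrupleTerm a b c x′ y′ z′ d′ → 0ℤ ≤ quadrupleTerm a b c x y z d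
    cong-term refl refl refl refl 0≤t = 0≤t
    cong₃-+ : ∀ {x x′ y y′ z z′} → x ≡ x′ → y ≡ y′ → z ≡ z′ → x + y + z ≡ x′ + y′ + z′
    cong₃-+ refl refl refl = refl
    distinct : Dec (i ≡ l) → Dec (j ≡ l) → Dec (k ≡ l) → 0ℤ ≤ term i j k l
    distinct (yes refl) _ _ = cong-term (diagonal i) (symmetric j i) (symmetric k i)
          (cong₃-+ (δ-diagonal i) (δ-off-diagonal (i≢j ∘ sym)) (δ-off-diagonal (i≢k ∘ sym)))
          (quadrupleTerm-i a ±a b ±b c ±c)
    distinct (no _) (yes refl) _ = cong-term refl (diagonal j) (symmetric k j)
          (cong₃-+ (δ-off-diagonal i≢j) (δ-diagonal j) (δ-off-diagonal (j≢k ∘ sym)))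
          (quadrupleTerm-j a ±a b ±b c ±c)
    distinct (no _) (no _) (yes refl) = cong-term refl refl (diagonal k)
          (cong₃-+ (δ-off-diagonal i≢k) (δ-off-diagonal j≢k) (δ-diagonal k))
          (quadrupleTerm-k a ±a b ±b c ±c)
    distinct (no i≢l) (no j≢l) (no k≢l) = cong-term refl refl refl
          (cong₃-+ (δ-off-diagonal i≢l) (δ-off-diagonal j≢l) (δ-off-diagonal k≢l))
          (quadrupleTerm-distinct a ±a b ±b c ±c (S i l) (off-diagonal i l i≢l)
            (S j l) (off-diagonal j l j≢l) (S k l) (off-diagonal k l k≢l))

  sum-δ-row : (i : Fin n) → sum (δ i) ≡ 1ℤ
  sum-δ-row i = trans (sum-cong-≗ λ j → sym (ℤ.*-identityˡ (δ i j))) (sum-δ (λ _ → 1ℤ) i)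

  -- Summed over `l`, the products give S² on the three edges. In the correction each of the three
  -- `δ` rows has sum 1, so it adds up to n - 2 · 3.
  sum-term : ∀ i j k →
    sum (term i j k) ≡ w i j k * (e i j + e j k + e i k + (ℤ.+ n + - (ℤ.+ 6)))
  sum-term i j k = begin
    sum (term i j k)
      ≡⟨ sym (*-distribˡ-sum (w i j k) (λ l → edges l + correction l)) ⟩
    w i j k * sum (λ l → edges l + correction l)
      ≡⟨ cong (w i j k *_) (trans (∑-distrib-+ edges correction) (cong₂ _+_ sum-edges sum-corrections)) ⟩
    w i j k * (e i j + e j k + e i k + (ℤ.+ n + - (ℤ.+ 6))) ∎
    where
    open ≡-Reasoning
    a = S i j
    b = S j k
    c = S i k
    edges correction : Vector ℤ n
    correction l = 1ℤ + - (ℤ.+ 2) * (δ i l + δ j l + δ k l)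
    edges l = a * S i l * S j l + b * S j l * S k l + c * S i l * S k l
    sum-edge : ∀ s i j → sum (λ l → s * S i l * S j l) ≡ s * q i j
    sum-edge s i j = trans (sum-cong-≗ λ l → ℤ.*-assoc s (S i l) (S j l))
      (sym (*-distribˡ-sum s (λ l → S i l * S j l)))
    sum-edges : sum edges ≡ e i j + e j k + e i k
    sum-edges = trans
      (trans (∑-distrib-+ (λ l → a * S i l * S j l + b * S j l * S k l) (λ l → c * S i l * S k l))
        (cong (_+ sum (λ l → c * S i l * S k l))
          (∑-distrib-+ (λ l → a * S i l * S j l) (λ l → b * S j l * S k l))))
      (cong₂ _+_ (cong₂ _+_ (sum-edge a i j) (sum-edge b j k)) (sum-edge c i k))
    sum-corrections : sum correction ≡ ℤ.+ n + - (ℤ.+ 6)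
    sum-corrections = trans (∑-distrib-+ (λ _ → 1ℤ) (λ l → - (ℤ.+ 2) * (δ i l + δ j l + δ k l)))
      (cong₂ _+_ (sum-1 n)
        (trans (sym (*-distribˡ-sum (- (ℤ.+ 2)) (λ l → δ i l + δ j l + δ k l)))
          (cong (- (ℤ.+ 2) *_)
            (trans (trans (∑-distrib-+ (λ l → δ i l + δ j l) (δ k))
                     (cong (_+ sum (δ k)) (∑-distrib-+ (δ i) (δ j))))
              (cong₂ _+_ (cong₂ _+_ (sum-δ-row i) (sum-δ-row j)) (sum-δ-row k))))))

  -- For an edge this is 2t: `u²` counts the n - 2 remaining vertices and `u` adds up to `e`. The
  -- factor Sᵢⱼ² makes the formula hold on the diagonal too.
  sum-w : ∀ i j → sum (w i j) ≡ (ℤ.+ n + - (ℤ.+ 2)) * (S i j * S i j) + e i j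
  sum-w i j = begin
    sum (w i j)
      ≡⟨ sum-cong-≗ (λ k → trans (expand a (S j k) (S i k))
           (cong (λ t → a * a * t + a * (S i k * S j k)) (cong₂ _*_ (square-entry j k) (square-entry i k)))) ⟩
    sum (λ k → a * a * ((1ℤ + - δ j k) * (1ℤ + - δ i k)) + a * (S i k * S j k))
      ≡⟨ trans (∑-distrib-+ (λ k → a * a * ((1ℤ + - δ j k) * (1ℤ + - δ i k))) (λ k → a * (S i k * S j k)))
           (cong₂ _+_ (sym (*-distribˡ-sum (a * a) (λ k → (1ℤ + - δ j k) * (1ℤ + - δ i k))))
             (sym (*-distribˡ-sum a (λ k → S i k * S j k)))) ⟩
    a * a * sum (λ k → (1ℤ + - δ j k) * (1ℤ + - δ i k)) + e i j
      ≡⟨ cong (λ t → a * a * t + e i j) common ⟩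
    a * a * (ℤ.+ n + - (ℤ.+ 2) + δ i j) + e i j
      ≡⟨ cong (_+ e i j) drop-δ ⟩
    (ℤ.+ n + - (ℤ.+ 2)) * (a * a) + e i j ∎
    where
    open ≡-Reasoning
    a = S i j
    expand : ∀ a b c → a * b * c * (a * b * c) + a * b * c ≡ a * a * ((b * b) * (c * c)) + a * (c * b)
    expand = solve-∀
    expand′ : ∀ x y → (1ℤ + - x) * (1ℤ + - y) ≡ (1ℤ + -1ℤ * x) + (-1ℤ * y + x * y)
    expand′ = solve-∀
    regroup : ∀ m d → (m + -1ℤ) + (-1ℤ + d) ≡ m + - (1ℤ + 1ℤ) + d
    regroup = solve-∀
    sum-neg-δ : ∀ i → sum (λ k → -1ℤ * δ i k) ≡ -1ℤ
    sum-neg-δ i = trans (sym (*-distribˡ-sum -1ℤ (δ i))) (cong (-1ℤ *_) (sum-δ-row i))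
    -- Counts the `k` different from both `i` and `j`; when i = j only one index is excluded, which
    -- `δ i j` restores.
    common : sum (λ k → (1ℤ + - δ j k) * (1ℤ + - δ i k)) ≡ ℤ.+ n + - (ℤ.+ 2) + δ i j
    common = begin
      sum (λ k → (1ℤ + - δ j k) * (1ℤ + - δ i k))
        ≡⟨ sum-cong-≗ (λ k → expand′ (δ j k) (δ i k)) ⟩
      sum (λ k → (1ℤ + -1ℤ * δ j k) + (-1ℤ * δ i k + δ j k * δ i k))
        ≡⟨ trans (∑-distrib-+ (λ k → 1ℤ + -1ℤ * δ j k) (λ k → -1ℤ * δ i k + δ j k * δ i k))
             (cong₂ _+_ (∑-distrib-+ (λ _ → 1ℤ) (λ k → -1ℤ * δ j k))
               (∑-distrib-+ (λ k → -1ℤ * δ i k) (λ k → δ j k * δ i k))) ⟩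
      (sum {n} (λ _ → 1ℤ) + sum (λ k → -1ℤ * δ j k)) + (sum (λ k → -1ℤ * δ i k) + sum (λ k → δ j k * δ i k))
        ≡⟨ cong₂ _+_ (cong₂ _+_ (sum-1 n) (sum-neg-δ j))
             (cong₂ _+_ (sum-neg-δ i) (trans (sum-δ (δ j) i) (δ-sym j i))) ⟩
      (ℤ.+ n + -1ℤ) + (-1ℤ + δ i j)
        ≡⟨ regroup (ℤ.+ n) (δ i j) ⟩
      ℤ.+ n + - (ℤ.+ 2) + δ i j ∎
    drop-δ : a * a * (ℤ.+ n + - (ℤ.+ 2) + δ i j) ≡ (ℤ.+ n + - (ℤ.+ 2)) * (a * a)
    drop-δ with i ≟ j
    ... | yes refl rewrite diagonal i = sym (ℤ.*-zeroʳ (ℤ.+ n + - (ℤ.+ 2)))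
    ... | no _ = trans (cong (a * a *_) (ℤ.+-identityʳ (ℤ.+ n + - (ℤ.+ 2))))
                       (ℤ.*-comm (a * a) (ℤ.+ n + - (ℤ.+ 2)))

  -- In terms of t the factors at an edge are 6t - 2n and 2t, so this is the sum of 4t(3t - n) over
  -- the edges at `i`; the diagonal term is 0.
  rowSum : Fin n → ℤ
  rowSum i = sum λ j →
    (ℤ.+ 3 * e i j + (ℤ.+ n + - (ℤ.+ 6))) * ((ℤ.+ n + - (ℤ.+ 2)) * (S i j * S i j) + e i j)

  0≤sum-rowSum : 0ℤ ≤ sum rowSum
  0≤sum-rowSum = subst (0ℤ ≤_) total
    (sum-nonneg λ i → sum-nonneg λ j → sum-nonneg λ k → sum-nonneg λ l → 0≤term i j k l)
    where
    total : ∑³ (λ i j k → sum (term i j k)) ≡ sum rowSum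
    total = trans (∑³-cong {g = λ i j k → sum (term i j k)} sum-term)
      (trans (∑³-edges w e (ℤ.+ n + - (ℤ.+ 6)) w-rotate w-swap)
        (sum-cong-≗ λ i → sum-cong-≗ λ j →
          cong ((ℤ.+ 3 * e i j + (ℤ.+ n + - (ℤ.+ 6))) *_) (sum-w i j)))

-- Evaluation for order 18

module SeidelOrder18 (S : Matrix ℤ n) (isSeidel : IsSeidel S) (hasSpectrum : HasSpectrum S spectrum)
  -- The order enters as an equation, so that `n` stays a variable and sums over `Fin n` do not
  -- unfold into 18 summands.
  (order : ℤ.+ n ≡ ℤ.+ 18) where

  open IsSeidel isSeidel
  open PolynomialAction S
  open SelfAdjoint S symmetric
  open SeidelInequality S isSeidel
  open ≡-Reasoning

  -- Row `i` of S³ = -5S² + 33S - 27I; by symmetry `mul (S i)` is row `i` of S².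
  cubic-relation : ∀ i x →
    mul (mul (S i)) x ≡ - (ℤ.+ 5) * mul (S i) x + ℤ.+ 33 * S i x + - (ℤ.+ 27) * δ i x
  cubic-relation i x = isolate (mul (mul (S i)) x) (mul (S i) x) (S i x) (δ i x) (begin
    ℤ.+ 27 * δ i x + (- (ℤ.+ 33) * S i x + (ℤ.+ 5 * mul (S i) x + 1ℤ * mul (mul (S i)) x))
      ≡⟨ sym (act-minimalPoly (δ i) (S i) (λ y → trans (mul-δ i y) (symmetric y i))) ⟩
    act minimalPoly (δ i) x
      ≡⟨ MinimalPolynomial.minimalPoly-kills S symmetric hasSpectrum i x ⟩
    0ℤ ∎)
    where
    -- `act` applies `mul` outermost; moving it inwards exposes the successive vectors v, S v, S² v.
    act-∷ : ∀ a p v {v′} → mul v ≗ v′ → act (a ∷ p) v x ≡ a * v x + act p v′ x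
    act-∷ a p v mulv≗v′ = cong (a * v x +_) (trans (sym (act-mul p v x)) (act-cong p mulv≗v′ x))
    act-minimalPoly : ∀ v v′ → mul v ≗ v′ → act minimalPoly v x ≡
      ℤ.+ 27 * v x + (- (ℤ.+ 33) * v′ x + (ℤ.+ 5 * mul v′ x + 1ℤ * mul (mul v′) x))
    act-minimalPoly v v′ mulv≗v′ = begin
      act minimalPoly v x
        ≡⟨ act-∷ (ℤ.+ 27) (- (ℤ.+ 33) ∷ ℤ.+ 5 ∷ 1ℤ ∷ []) v mulv≗v′ ⟩
      ℤ.+ 27 * v x + act (- (ℤ.+ 33) ∷ ℤ.+ 5 ∷ 1ℤ ∷ []) v′ x
        ≡⟨ cong (ℤ.+ 27 * v x +_) (act-∷ (- (ℤ.+ 33)) (ℤ.+ 5 ∷ 1ℤ ∷ []) v′ (λ _ → refl)) ⟩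
      ℤ.+ 27 * v x + (- (ℤ.+ 33) * v′ x + act (ℤ.+ 5 ∷ 1ℤ ∷ []) (mul v′) x)
        ≡⟨ cong (λ t → ℤ.+ 27 * v x + (- (ℤ.+ 33) * v′ x + t))
             (trans (act-∷ (ℤ.+ 5) (1ℤ ∷ []) (mul v′) (λ _ → refl))
               (cong (ℤ.+ 5 * mul v′ x +_) (act-const 1ℤ (mul (mul v′)) x))) ⟩
      ℤ.+ 27 * v x + (- (ℤ.+ 33) * v′ x + (ℤ.+ 5 * mul v′ x + 1ℤ * mul (mul v′) x)) ∎
    isolate : ∀ a₃ a₂ a₁ a₀ → ℤ.+ 27 * a₀ + (- (ℤ.+ 33) * a₁ + (ℤ.+ 5 * a₂ + 1ℤ * a₃)) ≡ 0ℤ →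
              a₃ ≡ - (ℤ.+ 5) * a₂ + ℤ.+ 33 * a₁ + - (ℤ.+ 27) * a₀
    isolate a₃ a₂ a₁ a₀ eq = trans (rearrange a₃ a₂ a₁ a₀)
      (trans (cong (_+ (- (ℤ.+ 5) * a₂ + ℤ.+ 33 * a₁ + - (ℤ.+ 27) * a₀)) eq) (ℤ.+-identityˡ _))
      where
      rearrange : ∀ a₃ a₂ a₁ a₀ → a₃ ≡
        (ℤ.+ 27 * a₀ + (- (ℤ.+ 33) * a₁ + (ℤ.+ 5 * a₂ + 1ℤ * a₃))) +
        (- (ℤ.+ 5) * a₂ + ℤ.+ 33 * a₁ + - (ℤ.+ 27) * a₀)
      rearrange = solve-∀

  q-sym : ∀ i j → q i j ≡ q j i
  q-sym i j = sum-cong-≗ λ l → ℤ.*-comm (S i l) (S j l)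

  q-diagonal : ∀ i → q i i ≡ ℤ.+ 17
  q-diagonal i = begin
    sum (λ l → S i l * S i l)
      ≡⟨ sum-cong-≗ (λ l → trans (square-entry i l) (cong (1ℤ +_) (sym (ℤ.-1*i≡-i (δ i l))))) ⟩
    sum (λ l → 1ℤ + -1ℤ * δ i l)
      ≡⟨ ∑-distrib-+ (λ _ → 1ℤ) (λ l → -1ℤ * δ i l) ⟩
    sum {n} (λ _ → 1ℤ) + sum (λ l → -1ℤ * δ i l)
      ≡⟨ cong₂ _+_ (trans (sum-1 n) order)
           (trans (sym (*-distribˡ-sum -1ℤ (δ i))) (cong (-1ℤ *_) (sum-δ-row i))) ⟩
    ℤ.+ 17 ∎

  -- The diagonal entry of S³: -5 · 17 + 33 · 0 - 27.
  trace-cube : ∀ i → ⟨ S i , mul (S i) ⟩ ≡ - (ℤ.+ 112)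
  trace-cube i = begin
    mul (mul (S i)) i
      ≡⟨ cubic-relation i i ⟩
    - (ℤ.+ 5) * q i i + ℤ.+ 33 * S i i + - (ℤ.+ 27) * δ i i
      ≡⟨ cong₂ _+_ (cong₂ (λ s t → - (ℤ.+ 5) * s + ℤ.+ 33 * t) (q-diagonal i) (diagonal i))
           (cong (- (ℤ.+ 27) *_) (δ-diagonal i)) ⟩
    - (ℤ.+ 112) ∎

  -- The diagonal entry of S⁴, from S times the cubic relation: -5 · (-112) + 33 · 17 - 27 · 0.
  trace-fourth : ∀ i → ⟨ mul (S i) , mul (S i) ⟩ ≡ ℤ.+ 1121
  trace-fourth i = begin
    ⟨ mul (S i) , mul (S i) ⟩
      ≡⟨ mul-self-adjoint (S i) (mul (S i)) ⟩
    ⟨ S i , mul (mul (S i)) ⟩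
      ≡⟨ ⟨⟩-congʳ (S i) (cubic-relation i) ⟩
    ⟨ S i , (λ x → - (ℤ.+ 5) * mul (S i) x + ℤ.+ 33 * S i x + - (ℤ.+ 27) * δ i x) ⟩
      ≡⟨ trans (⟨⟩-+ʳ (S i) (λ x → - (ℤ.+ 5) * mul (S i) x + ℤ.+ 33 * S i x) (λ x → - (ℤ.+ 27) * δ i x))
           (cong₂ _+_
             (trans (⟨⟩-+ʳ (S i) (λ x → - (ℤ.+ 5) * mul (S i) x) (λ x → ℤ.+ 33 * S i x))
               (cong₂ _+_ (⟨⟩-*ʳ (S i) (- (ℤ.+ 5)) (mul (S i))) (⟨⟩-*ʳ (S i) (ℤ.+ 33) (S i))))
             (⟨⟩-*ʳ (S i) (- (ℤ.+ 27)) (δ i))) ⟩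
    - (ℤ.+ 5) * ⟨ S i , mul (S i) ⟩ + ℤ.+ 33 * q i i + - (ℤ.+ 27) * ⟨ S i , δ i ⟩
      ≡⟨ cong₂ _+_ (cong₂ (λ s t → - (ℤ.+ 5) * s + ℤ.+ 33 * t) (trace-cube i) (q-diagonal i))
           (cong (- (ℤ.+ 27) *_) (trans (sum-δ (S i) i) (diagonal i))) ⟩
    ℤ.+ 1121 ∎

  sum-const : ∀ c → sum {n} (λ _ → c) ≡ c * ℤ.+ 18
  sum-const c = begin
    sum {n} (λ _ → c)
      ≡⟨ sum-cong-≗ {n} (λ _ → sym (ℤ.*-identityʳ c)) ⟩
    sum {n} (λ _ → c * 1ℤ)
      ≡⟨ sym (*-distribˡ-sum {n} c (λ _ → 1ℤ)) ⟩
    c * sum {n} (λ _ → 1ℤ)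
      ≡⟨ cong (c *_) (trans (sum-1 n) order) ⟩
    c * ℤ.+ 18 ∎

  -- The expansion in `rowTerm` uses Sᵢⱼ² = 1. On the diagonal its left side is 0, and this term
  -- cancels the surplus 3q² + 192.
  diagonalPart : Fin n → Fin n → ℤ
  diagonalPart i j = - (ℤ.+ 3 * (q i j * q i j) + ℤ.+ 192)

  rowTerm : ∀ i j → (ℤ.+ 3 * e i j + ℤ.+ 12) * (ℤ.+ 16 * (S i j * S i j) + e i j) ≡
    ℤ.+ 60 * e i j + ℤ.+ 3 * (q i j * q i j) + ℤ.+ 192 + diagonalPart i j * δ i j
  rowTerm i j with i ≟ j
  ... | yes refl rewrite diagonal i = on-diagonal (q i i * q i i)
    where
    on-diagonal : ∀ t → 0ℤ ≡ 0ℤ + ℤ.+ 3 * t + ℤ.+ 192 + - (ℤ.+ 3 * t + ℤ.+ 192) * 1ℤ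
    on-diagonal = solve-∀
  ... | no i≢j with off-diagonal i j i≢j
  ...   | inj₁ eq rewrite eq = positive (q i j)
    where
    positive : ∀ t → (ℤ.+ 3 * (1ℤ * t) + ℤ.+ 12) * (ℤ.+ 16 + 1ℤ * t) ≡
      ℤ.+ 60 * (1ℤ * t) + ℤ.+ 3 * (t * t) + ℤ.+ 192 + - (ℤ.+ 3 * (t * t) + ℤ.+ 192) * 0ℤ
    positive = solve-∀
  ...   | inj₂ eq rewrite eq = negative (q i j)
    where
    negative : ∀ t → (ℤ.+ 3 * (- 1ℤ * t) + ℤ.+ 12) * (ℤ.+ 16 + - 1ℤ * t) ≡
      ℤ.+ 60 * (- 1ℤ * t) + ℤ.+ 3 * (t * t) + ℤ.+ 192 + - (ℤ.+ 3 * (t * t) + ℤ.+ 192) * 0ℤ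
    negative = solve-∀

  rowSum-value : ∀ i → rowSum i ≡ - (ℤ.+ 960)
  rowSum-value i = begin
    rowSum i
      ≡⟨ sum-cong-≗ (λ j → trans
           (cong₂ (λ c d → (ℤ.+ 3 * e i j + c) * (d * (S i j * S i j) + e i j)) order-6 order-2)
           (rowTerm i j)) ⟩
    sum (λ j → ℤ.+ 60 * e i j + ℤ.+ 3 * (q i j * q i j) + ℤ.+ 192 + diagonalPart i j * δ i j)
      ≡⟨ trans (∑-distrib-+ (λ j → ℤ.+ 60 * e i j + ℤ.+ 3 * (q i j * q i j) + ℤ.+ 192) (λ j → diagonalPart i j * δ i j))
           (cong₂ _+_
             (trans (∑-distrib-+ (λ j → ℤ.+ 60 * e i j + ℤ.+ 3 * (q i j * q i j)) (λ _ → ℤ.+ 192))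
               (cong₂ _+_
                 (trans (∑-distrib-+ (λ j → ℤ.+ 60 * e i j) (λ j → ℤ.+ 3 * (q i j * q i j)))
                   (cong₂ _+_ (sym (*-distribˡ-sum (ℤ.+ 60) (e i)))
                     (sym (*-distribˡ-sum (ℤ.+ 3) (λ j → q i j * q i j)))))
                 (sum-const (ℤ.+ 192))))
             (sum-δ (diagonalPart i) i)) ⟩
    ℤ.+ 60 * sum (e i) + ℤ.+ 3 * sum (λ j → q i j * q i j) + ℤ.+ 192 * ℤ.+ 18 + diagonalPart i i
      -- The value is -6720 + 3363 + 3456 - 1059, where 1059 = 3 · 17² + 192.
      ≡⟨ evaluate sum-e sum-q² diagonalPart-value ⟩
    - (ℤ.+ 960) ∎
    where
    evaluate : ∀ {s t r : ℤ} → s ≡ - (ℤ.+ 112) → t ≡ ℤ.+ 1121 → r ≡ - (ℤ.+ 1059) →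
      ℤ.+ 60 * s + ℤ.+ 3 * t + ℤ.+ 192 * ℤ.+ 18 + r ≡ - (ℤ.+ 960)
    evaluate refl refl refl = refl
    order-6 : ℤ.+ n + - (ℤ.+ 6) ≡ ℤ.+ 12
    order-6 = cong (_+ - (ℤ.+ 6)) order
    order-2 : ℤ.+ n + - (ℤ.+ 2) ≡ ℤ.+ 16
    order-2 = cong (_+ - (ℤ.+ 2)) order
    diagonalPart-value : diagonalPart i i ≡ - (ℤ.+ 1059)
    diagonalPart-value = cong (λ t → - (ℤ.+ 3 * (t * t) + ℤ.+ 192)) (q-diagonal i)
    sum-e : sum (e i) ≡ - (ℤ.+ 112)
    sum-e = trans (sum-cong-≗ λ j → cong (S i j *_) (q-sym i j)) (trace-cube i)
    sum-q² : sum (λ j → q i j * q i j) ≡ ℤ.+ 1121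
    sum-q² = trans (sum-cong-≗ λ j → cong₂ _*_ (q-sym i j) (q-sym i j)) (trace-fourth i)

  contradictory : ⊥
  contradictory = negative
    (subst (0ℤ ≤_) (trans (sum-cong-≗ rowSum-value) (sum-const (- (ℤ.+ 960)))) 0≤sum-rowSum)
    where
    negative : ¬ (0ℤ ≤ - (ℤ.+ 960) * ℤ.+ 18)
    negative ()

open import Data.Integer.Base using (+_)

theorem4p7 : ¬ (∃ λ (S : Matrix ℤ 18) →
    IsSeidel S × HasSpectrum S (([ - (+ 9) ]^ 3) ++ ([ + 1 ]^ 9) ++ ([ + 3 ]^ 6)))
theorem4p7 (S , isSeidel , hasSpectrum) = SeidelOrder18.contradictory S isSeidel hasSpectrum refl
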